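{- Let $K_1,K_2$ be finite simplicial complexes on disjoint vertex sets, let $k\ge 0$, and let $K=K_1\vee_k K_2$ be a $k$-wedge sum obtained by identifying a $k$-face $F_1$ of $K_1$ with a $k$-face $F_2$ of $K_2$. If $i\ge k-1$ (and $i\ge 0$), then $B_i(K)$ is balanced if and only if both $B_i(K_1)$ and $B_i(K_2)$ are balanced.
   Context: $S_j(K)$ denotes the set of faces of cardinality $j+1$. The $k$-wedge sum: given $F_1=\{v_0,\dots,v_k\}\in S_k(K_1)$, $F_2=\{u_0,\dots,u_k\}\in S_k(K_2)$ and a bijection $v_j\mapsto u_j$, $K_1\vee_kK_2$ is the complex obtained from $K_1\cup K_2$ by identifying $v_j$ with $u_j$ for all $j$ (so $F_1$ and all its subfaces are identified with $F_2$ and its subfaces). For a complex $K$ with an orientation (ordering of each face up to even permutations), $B_i(K)$ is the signed bipartite graph with vertex set $S_i(K)\cup S_{i+1}(K)$, an edge $\{F,\bar F\}$ whenever $F\subset\bar F$, with sign $\mathrm{sgn}([F],\partial[\bar F])$ (equal to $(-1)^j$ if $F$ is $\bar F$ with its $j$-th vertex removed and the orientation of $F$ agrees with the induced one, and $-(-1)^j$ otherwise). A signed graph is balanced if every cycle has positive sign (product of edge signs); balancedness of $B_i(K)$ does not depend on the chosen orientation. -}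

module Defs where

open import Data.Bool.Base using (if_then_else_; _∧_)
open import Data.Bool.Properties using () renaming (_≟_ to _≟ᵇ_)
open import Data.Empty using (⊥)
open import Data.Fin.Base using (Fin; toℕ; _↑ˡ_; _↑ʳ_)
open import Data.Fin.Properties using (any?; _≟_; _<?_)
open import Data.Fin.Subset using (Subset; _∈_; _∉_; _⊆_; _⊂_; ∣_∣; _-_)
open import Data.Fin.Subset.Properties
  using (_∈?_; anySubset?; ⊆-antisym; p⊂q⇒∣p∣<∣q∣; x∈p∧x≢y⇒x∈p-y; x∈p⇒p-x⊂p)
open import Data.List.Base using (List; []; _∷_; length)
open import Data.List.Relation.Unary.Unique.Propositional using (Unique)
open import Data.Nat.Base using (ℕ; zero; suc; _+_; _≤_)
open import Data.Nat.Properties using (+-0-commutativeMonoid; <-irrefl; ≤-<-trans)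
  renaming (_≟_ to _≟ⁿ_)
open import Data.Product.Base using (∃; _×_; _,_; map₂)
open import Data.Sign.Base using (Sign; opposite) renaming (+ to +ˢ; _*_ to _*ˢ_)
open import Data.Sum.Base using (_⊎_; inj₁; inj₂)
open import Data.Vec.Base using (tabulate)
open import Data.Vec.Properties using (≡-dec; lookup∘tabulate; []=⇒lookup; lookup⇒[]=)
open import Data.Vec.Properties.WithK using ([]=-irrelevant)
open import Function.Base using (_∘_)
open import Function.Bundles using (_↔_; Inverse)
open import Relation.Binary.Construct.Closure.ReflexiveTransitive using (Star; ε; _◅_)
open import Relation.Binary.PropositionalEquality
  using (_≡_; refl; sym; trans; cong; cong₂)
open import Relation.Nullary.Decidable
  using (Dec; yes; no; does; ⌊_⌋; _×-dec_; _⊎-dec_; dec-true; recompute)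
open import Relation.Nullary.Negation using (contradiction)
open import Algebra.Properties.CommutativeMonoid.Sum +-0-commutativeMonoid
  using (sum; sum-cong-≗)

-- Fin n is only an ambient set for the vertices of a complex: a point x such
-- that { x } is not a face is not a vertex.  The empty set may be a face; it
-- plays no role in the graphs B i K below, where i ≥ 0.
record SimplicialComplex (n : ℕ) : Set₁ where
  field
    IsFace      : Subset n → Set
    isFace?     : ∀ F → Dec (IsFace F)
    down-closed : ∀ {F G} → IsFace F → G ⊆ F → IsFace G

open SimplicialComplex public

-- The proof fields are irrelevant, so two elements are equal as soon as the
-- underlying sets are.
record S {n : ℕ} (d : ℕ) (K : SimplicialComplex n) : Set where
  constructor mkS
  field
    set   : Subset n
    .face : IsFace K set
    .card : ∣ set ∣ ≡ suc d

open S public using (set)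

Ordering : {n : ℕ} → ℕ → Subset n → Set
Ordering m F = Fin m ↔ ∃ (_∈ F)

-- A representative ordering of each face.  The sign sgn below depends only on
-- the classes of these orderings up to even permutations.
Orientation : {n : ℕ} → SimplicialComplex n → Set
Orientation {n} K = (F : Subset n) → .(IsFace K F) → Ordering ∣ F ∣ F

[-1]^_ : ℕ → Sign
[-1]^ zero  = +ˢ
[-1]^ suc k = opposite ([-1]^ k)

inversions : {m p : ℕ} → (Fin m → Fin p) → ℕ
inversions q = sum λ a → sum λ b → if ⌊ a <? b ⌋ ∧ ⌊ q b <? q a ⌋ then 1 else 0

module _ {n m p : ℕ} {F G : Subset n} (v : Ordering m F) (w : Ordering p G) where

  positions : F ⊆ G → Fin m → Fin p
  positions F⊆G a = Inverse.from w (map₂ F⊆G (Inverse.to v a))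

  -- Let G have one more vertex than F.  The x supplied by F ⊂ G is then the
  -- removed vertex, and its position j in w, counted from 0, gives (-1)^j.  The
  -- induced ordering of F lists its vertices in the order in which they occur in
  -- w, so the permutation from it to v has the same inversions as `positions`:
  -- the second factor is + exactly if v agrees with the induced ordering up to
  -- an even permutation.
  sgn : F ⊂ G → Sign
  sgn (F⊆G , x , x∈G , x∉F) =
    [-1]^ toℕ (Inverse.from w (x , x∈G)) *ˢ [-1]^ inversions (positions F⊆G)

  position-cong : ∀ {x y} (x∈G : x ∈ G) (y∈G : y ∈ G) → x ≡ y →
                  Inverse.from w (x , x∈G) ≡ Inverse.from w (y , y∈G)
  position-cong x∈G y∈G refl =
    cong (λ z → Inverse.from w (_ , z)) ([]=-irrelevant x∈G y∈G)

  inversions-cong : {f g : Fin m → Fin p} → (∀ a → f a ≡ g a) →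
                    inversions f ≡ inversions g
  inversions-cong f≗g = sum-cong-≗ λ a → sum-cong-≗ λ b →
    cong₂ (λ s t → if ⌊ a <? b ⌋ ∧ ⌊ s <? t ⌋ then 1 else 0) (f≗g b) (f≗g a)

  removed-unique : ∀ {x y} → ∣ G ∣ ≡ suc ∣ F ∣ → F ⊆ G →
                   x ∈ G → x ∉ F → y ∈ G → y ∉ F → x ≡ y
  removed-unique {x} {y} card F⊆G x∈G x∉F y∈G y∉F with x ≟ y
  ... | yes x≡y = x≡y
  ... | no  x≢y = contradiction
    (≤-<-trans (p⊂q⇒∣p∣<∣q∣ F⊂G-x) (p⊂q⇒∣p∣<∣q∣ (x∈p⇒p-x⊂p x∈G)))
    (<-irrefl (sym card))
    where
    F⊂G-x : F ⊂ (G - x)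
    F⊂G-x = (λ z∈F → x∈p∧x≢y⇒x∈p-y (F⊆G z∈F) λ { refl → x∉F z∈F })
          , y , x∈p∧x≢y⇒x∈p-y y∈G (x≢y ∘ sym) , y∉F

  sgn-unique : ∣ G ∣ ≡ suc ∣ F ∣ → (e e′ : F ⊂ G) → sgn e ≡ sgn e′
  sgn-unique card (sub , x , x∈G , x∉F) (sub′ , y , y∈G , y∉F) = cong₂ _*ˢ_
    (cong (λ j → [-1]^ toℕ j)
      (position-cong x∈G y∈G (removed-unique card sub x∈G x∉F y∈G y∉F)))
    (cong [-1]^_ (inversions-cong λ a → position-cong _ _ refl))

record SignedGraph : Set₁ where
  field
    Vertex      : Set
    Edge        : Vertex → Vertex → Set
    edge-sym    : ∀ {x y} → Edge x y → Edge y x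
    sign        : ∀ {x y} → Edge x y → Sign
    sign-sym    : ∀ {x y} (e : Edge x y) → sign (edge-sym e) ≡ sign e
    sign-unique : ∀ {x y} (e e′ : Edge x y) → sign e ≡ sign e′

module _ (Γ : SignedGraph) where
  open SignedGraph Γ

  Walk : Vertex → Vertex → Set
  Walk = Star Edge

  -- Every vertex except the end point.
  vertices : ∀ {x y} → Walk x y → List Vertex
  vertices ε             = []
  vertices {x} (e ◅ es) = x ∷ vertices es

  walkSign : ∀ {x y} → Walk x y → Sign
  walkSign ε        = +ˢ
  walkSign (e ◅ es) = sign e *ˢ walkSign es

  IsCycle : ∀ {x} → Walk x x → Set
  IsCycle c = 3 ≤ length (vertices c) × Unique (vertices c)

  Balanced : Set
  Balanced = ∀ {x} (c : Walk x x) → IsCycle c → walkSign c ≡ +ˢ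

module _ {n : ℕ} (i : ℕ) (K : SimplicialComplex n) (o : Orientation K) where

  Vert : Set
  Vert = S i K ⊎ S (suc i) K

  Inc : Vert → Vert → Set
  Inc (inj₁ F) (inj₂ G) = set F ⊂ set G
  Inc (inj₂ G) (inj₁ F) = set F ⊂ set G
  Inc (inj₁ _) (inj₁ _) = ⊥
  Inc (inj₂ _) (inj₂ _) = ⊥

  Inc-sym : ∀ x y → Inc x y → Inc y x
  Inc-sym (inj₁ _) (inj₂ _) e = e
  Inc-sym (inj₂ _) (inj₁ _) e = e

  incSign : ∀ x y → Inc x y → Sign
  incSign (inj₁ (mkS F F∈K _)) (inj₂ (mkS G G∈K _)) = sgn (o F F∈K) (o G G∈K)
  incSign (inj₂ (mkS G G∈K _)) (inj₁ (mkS F F∈K _)) = sgn (o F F∈K) (o G G∈K)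

  incSign-sym : ∀ x y (e : Inc x y) → incSign y x (Inc-sym x y e) ≡ incSign x y e
  incSign-sym (inj₁ _) (inj₂ _) e = refl
  incSign-sym (inj₂ _) (inj₁ _) e = refl

  card-suc : (F : S i K) (G : S (suc i) K) → ∣ set G ∣ ≡ suc ∣ set F ∣
  card-suc (mkS F _ ∣F∣) (mkS G _ ∣G∣) =
    trans (recompute (_ ≟ⁿ _) ∣G∣) (cong suc (sym (recompute (_ ≟ⁿ _) ∣F∣)))

  incSign-unique : ∀ x y (e e′ : Inc x y) → incSign x y e ≡ incSign x y e′
  incSign-unique (inj₁ F@(mkS F′ F∈K _)) (inj₂ G@(mkS G′ G∈K _)) =
    sgn-unique (o F′ F∈K) (o G′ G∈K) (card-suc F G)
  incSign-unique (inj₂ G@(mkS G′ G∈K _)) (inj₁ F@(mkS F′ F∈K _)) =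
    sgn-unique (o F′ F∈K) (o G′ G∈K) (card-suc F G)

  B : SignedGraph
  B = record
    { Vertex      = Vert
    ; Edge        = Inc
    ; edge-sym    = λ {x} {y} → Inc-sym x y
    ; sign        = λ {x} {y} → incSign x y
    ; sign-sym    = λ {x} {y} → incSign-sym x y
    ; sign-unique = λ {x} {y} → incSign-unique x y
    }

comprehension : ∀ {n} {P : Fin n → Set} → (∀ x → Dec (P x)) → Subset n
comprehension P? = tabulate λ x → does (P? x)

∈-comprehension⁺ : ∀ {n} {P : Fin n → Set} (P? : ∀ x → Dec (P x)) →
                   ∀ {x} → P x → x ∈ comprehension P?
∈-comprehension⁺ P? {x} Px =
  lookup⇒[]= x _ (trans (lookup∘tabulate _ x) (dec-true (P? x) Px))

∈-comprehension⁻ : ∀ {n} {P : Fin n → Set} (P? : ∀ x → Dec (P x)) →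
                   ∀ {x} → x ∈ comprehension P? → P x
∈-comprehension⁻ P? {x} x∈
  with P? x | trans (sym (lookup∘tabulate _ x)) ([]=⇒lookup x∈)
... | yes Px | _  = Px
... | no  _  | ()

image : {m n : ℕ} → (Fin m → Fin n) → Subset m → Subset n
image f F = comprehension λ y → any? λ x → (x ∈? F) ×-dec (f x ≟ y)

module _ {m n : ℕ} (f : Fin m → Fin n) (F : Subset m) where

  ∃? : ∀ y → Dec (∃ λ x → x ∈ F × f x ≡ y)
  ∃? y = any? λ x → (x ∈? F) ×-dec (f x ≟ y)

  ∈-image⁺ : ∀ {x} → x ∈ F → f x ∈ image f F
  ∈-image⁺ x∈F = ∈-comprehension⁺ ∃? (_ , x∈F , refl)

  ∈-image⁻ : ∀ {y} → y ∈ image f F → ∃ λ x → x ∈ F × f x ≡ y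
  ∈-image⁻ = ∈-comprehension⁻ ∃?

IsImageFace : {m n : ℕ} → (Fin m → Fin n) → SimplicialComplex m → Subset n → Set
IsImageFace f K G = ∃ λ F → IsFace K F × image f F ≡ G

isImageFace? : ∀ {m n} (f : Fin m → Fin n) (K : SimplicialComplex m) →
               ∀ G → Dec (IsImageFace f K G)
isImageFace? f K G = anySubset? λ F → isFace? K F ×-dec ≡-dec _≟ᵇ_ (image f F) G

image-down-closed : ∀ {m n} (f : Fin m → Fin n) (K : SimplicialComplex m) →
                    ∀ {G H} → IsImageFace f K G → H ⊆ G → IsImageFace f K H
image-down-closed f K {H = H} (F , F∈K , refl) H⊆G =
  F′ , down-closed K F∈K (λ x∈F′ → let (x∈F , _) = ∈-comprehension⁻ P? x∈F′ in x∈F)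
     , ⊆-antisym sub sup
  where
  P? : ∀ x → Dec (x ∈ F × f x ∈ H)
  P? x = (x ∈? F) ×-dec (f x ∈? H)

  F′ : Subset _
  F′ = comprehension P?

  sub : image f F′ ⊆ H
  sub y∈ with ∈-image⁻ f F′ y∈
  ... | x , x∈F′ , refl = let (_ , fx∈H) = ∈-comprehension⁻ P? x∈F′ in fx∈H

  sup : H ⊆ image f F′
  sup y∈H with ∈-image⁻ f F (H⊆G y∈H)
  ... | x , x∈F , refl = ∈-image⁺ f F′ (∈-comprehension⁺ P? (x∈F , y∈H))

-- The wedge sum along v j ↦ u j.  Fin (n₁ + n₂) is the disjoint union of the two
-- ambient vertex sets; each u j is identified with v j by renaming it to v j, so
-- its own copy n₁ ↑ʳ u j is no longer a vertex.
module _ {n₁ n₂ k : ℕ} (K₁ : SimplicialComplex n₁) (K₂ : SimplicialComplex n₂)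
         (F₁ : S k K₁) (F₂ : S k K₂)
         (v : Ordering (suc k) (set F₁)) (u : Ordering (suc k) (set F₂)) where

  ι₁ : Fin n₁ → Fin (n₁ + n₂)
  ι₁ x = x ↑ˡ n₂

  ι₂ : Fin n₂ → Fin (n₁ + n₂)
  ι₂ y with y ∈? set F₂
  ... | yes y∈F₂ = let (x , _) = Inverse.to v (Inverse.from u (y , y∈F₂)) in ι₁ x
  ... | no  _    = n₁ ↑ʳ y

  wedge : SimplicialComplex (n₁ + n₂)
  wedge = record
    { IsFace      = λ G → IsImageFace ι₁ K₁ G ⊎ IsImageFace ι₂ K₂ G
    ; isFace?     = λ G → isImageFace? ι₁ K₁ G ⊎-dec isImageFace? ι₂ K₂ G
    ; down-closed = λ where
        (inj₁ G∈) H⊆G → inj₁ (image-down-closed ι₁ K₁ G∈ H⊆G)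
        (inj₂ G∈) H⊆G → inj₂ (image-down-closed ι₂ K₂ G∈ H⊆G)
    }

{-# OPTIONS --safe #-}

-- Changing orientations, or transporting them along an injection of the vertices,
-- multiplies the sign of each edge F — G by η F · η G for suitable signs η, hence
-- keeps the sign of every closed walk; and balance says that every closed walk is
-- positive.  So B i K is covered by switched copies of B i K₁ and B i K₂.  They
-- share the faces contained in the glued k-face C: none if k < i, only C if k = i,
-- and C with its facets, which is a star, if k = i + 1.  In each case the
-- intersection is connected when nonempty, so an excursion of a closed walk into
-- the second copy can be replaced by a walk of the same sign in the first one.
module Submission where

open import Data.Bool.Base using (Bool; true; false; not; _∧_; _xor_; if_then_else_)
open import Data.Bool.Properties using () renaming (_≟_ to _≟ᵇ_)
open import Data.Fin.Base using (Fin; zero; suc; toℕ; splitAt; _↑ʳ_)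
open import Data.Fin.Permutation using (Permutation; _∘ₚ_; lift₀; _⟨$⟩ʳ_; ↔⇒≡)
open import Data.Fin.Properties
  using (_≟_; _<?_; <-cmp; any?; splitAt-↑ˡ; splitAt-↑ʳ; ↑ˡ-injective; ↑ʳ-injective)
open import Data.Fin.Subset using (Subset; _∈_; _∉_; _⊆_; _⊂_; ∣_∣)
open import Data.Fin.Subset.Properties
  using (_∈?_; ⊆-antisym; p⊆q⇒∣p∣≤∣q∣; p⊂q⇒∣p∣<∣q∣)
open import Data.List.Base using (List; []; _∷_; _++_)
import Data.List.Membership.DecPropositional as DecMembership
open import Data.List.Membership.Propositional using () renaming (_∈_ to _∈ₗ_)
open import Data.List.Relation.Unary.All as All using (All; []; _∷_)
open import Data.List.Relation.Unary.All.Properties using (¬Any⇒All¬; ++⁻ˡ)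
open import Data.List.Relation.Unary.AllPairs using ([]; _∷_)
open import Data.List.Relation.Unary.Any using (here; there)
open import Data.List.Relation.Unary.Unique.Propositional using (Unique)
open import Data.Nat.Base using (ℕ; zero; suc; _+_; _≤_; _<_; z≤n; s≤s)
open import Data.Nat.Properties
  using (+-0-commutativeMonoid; suc-injective; +-suc; +-identityʳ;
         ≤-reflexive; <-irrefl; <⇒≱; m≤n⇒m<n∨m≡n; n<1+n)
  renaming (_≟_ to _≟ⁿ_)
open import Data.Product.Base using (∃; ∃₂; _×_; _,_; proj₁; proj₂)
open import Data.Sign.Base using (Sign; opposite) renaming (+ to +ˢ; - to -ˢ; _*_ to _*ˢ_)
open import Data.Sign.Properties
  using (s*s≡+; opposite-involutive; *-assoc; *-comm; *-identityʳ; *-cancelʳ-≡; *-cancelˡ-≡)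
open import Data.Sum.Base using (_⊎_; inj₁; inj₂; swap)
open import Data.Sum.Properties using (inj₁-injective; inj₂-injective)
  renaming (≡-dec to ⊎-≡-dec)
open import Data.Vec.Properties using () renaming (≡-dec to Vec-≡-dec)
open import Data.Vec.Properties.WithK using ([]=-irrelevant)
open import Function.Base using (_∘_)
open import Function.Bundles using (_↔_; _⇔_; mk⇔; mk↔ₛ′; Inverse; Injection)
open import Function.Definitions using (Injective)
open import Function.Properties.Inverse using (↔-sym; ↔-trans; ↔⇒↣)
open import Relation.Binary.Construct.Closure.ReflexiveTransitive using (ε; _◅_; _◅◅_)
open import Relation.Binary.Definitions using (DecidableEquality; tri<; tri≈; tri>)
open import Relation.Binary.PropositionalEquality
open import Relation.Nullary.Decidable
  using (yes; no; does; ⌊_⌋; isYes≗does; dec-true; dec-false; map′; recompute;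
         _×-dec_; ¬?; decidable-stable)
open import Relation.Nullary.Negation using (¬_; contradiction)
open import Defs

open import Algebra.Properties.CommutativeMonoid.Sum +-0-commutativeMonoid
  using (sum; ∑-distrib-+; ∑-comm; sum-permute; sum-cong-≗; sum-replicate-zero)

open ≡-Reasoning

-- Inversions and orientations

private variable
  m n p r : ℕ

⟦_⟧ : Bool → ℕ
⟦ b ⟧ = if b then 1 else 0

∑∑ : (Fin m → Fin m → ℕ) → ℕ
∑∑ f = sum λ a → sum λ b → f a b

∑∑-cong : {f g : Fin m → Fin m → ℕ} → (∀ a b → f a b ≡ g a b) → ∑∑ f ≡ ∑∑ g
∑∑-cong f≗g = sum-cong-≗ λ a → sum-cong-≗ (f≗g a)

∑∑-distrib-+ : (f g : Fin m → Fin m → ℕ) →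
               ∑∑ (λ a b → f a b + g a b) ≡ ∑∑ f + ∑∑ g
∑∑-distrib-+ f g =
  trans (sum-cong-≗ λ a → ∑-distrib-+ (f a) (g a)) (∑-distrib-+ (sum ∘ f) (sum ∘ g))

∑∑-permute : (f : Fin p → Fin p → ℕ) (π : Permutation m p) →
             ∑∑ f ≡ ∑∑ λ a b → f (π ⟨$⟩ʳ a) (π ⟨$⟩ʳ b)
∑∑-permute f π =
  trans (sum-permute (sum ∘ f) π) (sum-cong-≗ λ a → sum-permute (f (π ⟨$⟩ʳ a)) π)

lt : Fin m → Fin m → Bool
lt a b = does (a <? b)

lt-irrefl : (a : Fin m) → lt a a ≡ false
lt-irrefl a with <-cmp a a
... | tri< _ a≢a _ = contradiction refl a≢a
... | tri≈ a≮a _ _ = dec-false (a <? a) a≮a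
... | tri> _ a≢a _ = contradiction refl a≢a

lt-flip : {a b : Fin m} → a ≢ b → lt a b ≡ not (lt b a)
lt-flip {a = a} {b} a≢b with <-cmp a b
... | tri< a<b _ b≮a = trans (dec-true (a <? b) a<b) (sym (cong not (dec-false (b <? a) b≮a)))
... | tri≈ _ a≡b _   = contradiction a≡b a≢b
... | tri> a≮b _ b<a = trans (dec-false (a <? b) a≮b) (sym (cong not (dec-true (b <? a) b<a)))

inversions-lt : (q : Fin m → Fin p) →
                inversions q ≡ ∑∑ λ a b → ⟦ lt a b ∧ lt (q b) (q a) ⟧
inversions-lt q = ∑∑-cong λ a b →
  cong₂ (λ s t → ⟦ s ∧ t ⟧) (isYes≗does (a <? b)) (isYes≗does (q b <? q a))

module _ (h : Fin m → Fin m → Bool) (h-sym : ∀ a b → h a b ≡ h b a)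
         (h-irrefl : ∀ a → h a a ≡ false) where

  -- Summing over ordered pairs counts every unordered pair twice.
  ∑∑-symmetric : ∑∑ (λ a b → ⟦ h a b ⟧) ≡
                 ∑∑ (λ a b → ⟦ lt a b ∧ h a b ⟧) + ∑∑ (λ a b → ⟦ lt a b ∧ h a b ⟧)
  ∑∑-symmetric = begin
    ∑∑ (λ a b → ⟦ h a b ⟧)
      ≡⟨ ∑∑-cong split ⟩
    ∑∑ (λ a b → ⟦ lt a b ∧ h a b ⟧ + ⟦ lt b a ∧ h b a ⟧)
      ≡⟨ ∑∑-distrib-+ (λ a b → ⟦ lt a b ∧ h a b ⟧) (λ a b → ⟦ lt b a ∧ h b a ⟧) ⟩
    ∑∑ (λ a b → ⟦ lt a b ∧ h a b ⟧) + ∑∑ (λ a b → ⟦ lt b a ∧ h b a ⟧)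
      ≡⟨ cong (∑∑ (λ a b → ⟦ lt a b ∧ h a b ⟧) +_)
           (∑-comm λ a b → ⟦ lt b a ∧ h b a ⟧) ⟩
    ∑∑ (λ a b → ⟦ lt a b ∧ h a b ⟧) + ∑∑ (λ a b → ⟦ lt a b ∧ h a b ⟧) ∎
    where
    split : ∀ a b → ⟦ h a b ⟧ ≡ ⟦ lt a b ∧ h a b ⟧ + ⟦ lt b a ∧ h b a ⟧
    split a b with a ≟ b
    ... | yes refl rewrite lt-irrefl a | h-irrefl a = refl
    ... | no a≢b rewrite lt-flip a≢b | h-sym b a with lt b a
    ...   | true  = refl
    ...   | false = sym (+-identityʳ _)

m+m-injective : ∀ m n → m + m ≡ n + n → m ≡ n
m+m-injective zero    zero    _  = refl
m+m-injective (suc m) (suc n) eq = cong suc (m+m-injective m n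
  (suc-injective (trans (sym (+-suc m m)) (trans (suc-injective eq) (+-suc n n)))))

-- The exclusive or makes this symmetric in the pair when `g` is injective. The inversion condition
-- itself depends on the order of `c` and `d`, and so could not be reindexed by a permutation.
reverses : (Fin p → Fin r) → Fin p → Fin p → Bool
reverses g c d = lt c d xor lt (g c) (g d)

module _ (g : Fin p → Fin r) (g-inj : Injective _≡_ _≡_ g) where

  reverses-sym : ∀ c d → reverses g c d ≡ reverses g d c
  reverses-sym c d with c ≟ d
  ... | yes refl = refl
  ... | no c≢d rewrite lt-flip c≢d | lt-flip (c≢d ∘ g-inj) with lt d c | lt (g d) (g c)
  ...   | true  | true  = refl
  ...   | true  | false = refl
  ...   | false | true  = refl
  ...   | false | false = refl

  reverses-irrefl : ∀ c → reverses g c c ≡ false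
  reverses-irrefl c rewrite lt-irrefl c | lt-irrefl (g c) = refl

  inversions-reverses : inversions g ≡ ∑∑ λ c d → ⟦ lt c d ∧ reverses g c d ⟧
  inversions-reverses = trans (inversions-lt g) (∑∑-cong pair)
    where
    pair : ∀ c d → ⟦ lt c d ∧ lt (g d) (g c) ⟧ ≡ ⟦ lt c d ∧ reverses g c d ⟧
    pair c d with c ≟ d
    ... | yes refl rewrite lt-irrefl c = refl
    ... | no c≢d rewrite lt-flip (c≢d ∘ g-inj) with lt c d | lt (g d) (g c)
    ...   | true  | true  = refl
    ...   | true  | false = refl
    ...   | false | _     = refl

  -- Whether g reverses a pair does not depend on its order, so the count is
  -- invariant under relabelling the points by π.
  inversions-relabel : (π : Permutation m p) → inversions g ≡
    ∑∑ λ a b → ⟦ lt a b ∧ reverses g (π ⟨$⟩ʳ a) (π ⟨$⟩ʳ b) ⟧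
  inversions-relabel π = m+m-injective _ _ (begin
    inversions g + inversions g
      ≡⟨ cong₂ _+_ inversions-reverses inversions-reverses ⟩
    ∑∑ (λ c d → ⟦ lt c d ∧ reverses g c d ⟧) + ∑∑ (λ c d → ⟦ lt c d ∧ reverses g c d ⟧)
      ≡⟨ ∑∑-symmetric (reverses g) reverses-sym reverses-irrefl ⟨
    ∑∑ (λ c d → ⟦ reverses g c d ⟧)
      ≡⟨ ∑∑-permute (λ c d → ⟦ reverses g c d ⟧) π ⟩
    ∑∑ (λ a b → ⟦ reverses g (π ⟨$⟩ʳ a) (π ⟨$⟩ʳ b) ⟧)
      ≡⟨ ∑∑-symmetric (λ a b → reverses g (π ⟨$⟩ʳ a) (π ⟨$⟩ʳ b))
           (λ a b → reverses-sym (π ⟨$⟩ʳ a) (π ⟨$⟩ʳ b)) (λ a → reverses-irrefl (π ⟨$⟩ʳ a)) ⟩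
    _ ∎)

-- Signs of permutations

[-1]^-+ : ∀ a b → [-1]^ (a + b) ≡ [-1]^ a *ˢ [-1]^ b
[-1]^-+ zero    b = refl
[-1]^-+ (suc a) b = trans (cong opposite ([-1]^-+ a b)) (opposite-* ([-1]^ a) _)
  where
  opposite-* : ∀ s t → opposite (s *ˢ t) ≡ opposite s *ˢ t
  opposite-* +ˢ t = refl
  opposite-* -ˢ t = opposite-involutive t

[-1]^-even : ∀ a b → [-1]^ (a + (b + b)) ≡ [-1]^ a
[-1]^-even a b = begin
  [-1]^ (a + (b + b))                 ≡⟨ [-1]^-+ a (b + b) ⟩
  [-1]^ a *ˢ [-1]^ (b + b)            ≡⟨ cong ([-1]^ a *ˢ_) ([-1]^-+ b b) ⟩
  [-1]^ a *ˢ ([-1]^ b *ˢ [-1]^ b)     ≡⟨ cong ([-1]^ a *ˢ_) (s*s≡+ ([-1]^ b)) ⟩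
  [-1]^ a *ˢ +ˢ                       ≡⟨ *-identityʳ _ ⟩
  [-1]^ a                             ∎

permSign : Permutation m p → Sign
permSign π = [-1]^ inversions (π ⟨$⟩ʳ_)

↔-injective : (π : Permutation m p) → Injective _≡_ _≡_ (π ⟨$⟩ʳ_)
↔-injective π = Injection.injective (↔⇒↣ π)

-- A pair is inverted by the composite exactly when one of `q` and `g` reverses it but not the
-- other. Adding the pairs reversed by both, twice, gives the sum of the two inversion counts, and
-- an even number does not affect the sign.
permSign-∘ : (π : Permutation m p) (ρ : Permutation p r) →
             permSign (π ∘ₚ ρ) ≡ permSign π *ˢ permSign ρ
permSign-∘ {m} π ρ = begin
  [-1]^ inversions (g ∘ q)
    ≡⟨ [-1]^-even (inversions (g ∘ q)) both ⟨
  [-1]^ (inversions (g ∘ q) + (both + both))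
    ≡⟨ cong [-1]^_ count ⟩
  [-1]^ (inversions q + inversions g)
    ≡⟨ [-1]^-+ (inversions q) _ ⟩
  [-1]^ inversions q *ˢ [-1]^ inversions g ∎
  where
  q = π ⟨$⟩ʳ_
  g = ρ ⟨$⟩ʳ_
  inv inv-q inv-g inv-both : Fin m → Fin m → ℕ
  inv      a b = ⟦ lt a b ∧ lt (g (q b)) (g (q a)) ⟧
  inv-q    a b = ⟦ lt a b ∧ lt (q b) (q a) ⟧
  inv-g    a b = ⟦ lt a b ∧ reverses g (q a) (q b) ⟧
  inv-both a b = ⟦ lt a b ∧ (lt (q b) (q a) ∧ not (lt (g (q b)) (g (q a)))) ⟧
  both : ℕ
  both = ∑∑ inv-both

  pair : ∀ a b → inv a b + (inv-both a b + inv-both a b) ≡ inv-q a b + inv-g a b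
  pair a b with a ≟ b
  ... | yes refl rewrite lt-irrefl a = refl
  ... | no a≢b rewrite lt-flip (a≢b ∘ ↔-injective π)
                     | lt-flip (a≢b ∘ ↔-injective π ∘ ↔-injective ρ)
      with lt a b | lt (q b) (q a) | lt (g (q b)) (g (q a))
  ...   | false | _     | _     = refl
  ...   | true  | true  | true  = refl
  ...   | true  | true  | false = refl
  ...   | true  | false | true  = refl
  ...   | true  | false | false = refl

  count : inversions (g ∘ q) + (both + both) ≡ inversions q + inversions g
  count = begin
    inversions (g ∘ q) + (both + both)
      ≡⟨ cong (_+ (both + both)) (inversions-lt (g ∘ q)) ⟩
    ∑∑ inv + (both + both)
      ≡⟨ cong (∑∑ inv +_) (∑∑-distrib-+ inv-both inv-both) ⟨
    ∑∑ inv + ∑∑ (λ a b → inv-both a b + inv-both a b)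
      ≡⟨ ∑∑-distrib-+ inv (λ a b → inv-both a b + inv-both a b) ⟨
    ∑∑ (λ a b → inv a b + (inv-both a b + inv-both a b))
      ≡⟨ ∑∑-cong pair ⟩
    ∑∑ (λ a b → inv-q a b + inv-g a b)
      ≡⟨ ∑∑-distrib-+ inv-q inv-g ⟩
    ∑∑ inv-q + ∑∑ inv-g
      ≡⟨ cong₂ _+_ (inversions-lt q) (inversions-relabel g (↔-injective ρ) π) ⟨
    inversions q + inversions g ∎

∑-lt : (j : Fin p) → sum (λ c → ⟦ lt c j ⟧) ≡ toℕ j
∑-lt {suc p} zero    = sum-replicate-zero p
∑-lt {suc p} (suc j) = cong suc (∑-lt j)

-- Moving the value j = π 0 to the front of the list of values costs j inversions.
inversions-head : (π : Permutation (suc m) p) → inversions (π ⟨$⟩ʳ_) ≡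
                  toℕ (π ⟨$⟩ʳ zero) + inversions (λ a → π ⟨$⟩ʳ suc a)
inversions-head {m} {p} π = begin
  inversions q
    ≡⟨ inversions-lt q ⟩
  sum (λ b → ⟦ lt (q (suc b)) j ⟧) +
  sum (λ a → sum λ b → ⟦ lt a b ∧ lt (q (suc b)) (q (suc a)) ⟧)
    ≡⟨ cong₂ _+_ first (sym (inversions-lt (q ∘ suc))) ⟩
  toℕ j + inversions (q ∘ suc) ∎
  where
  q = π ⟨$⟩ʳ_
  j = q zero
  first : sum (λ b → ⟦ lt (q (suc b)) j ⟧) ≡ toℕ j
  first = begin
    sum (λ b → ⟦ lt (q (suc b)) j ⟧)
      -- The added term `lt j j` contributes 0 and completes the sum to all of `Fin (suc m)`, where
      -- it can be reindexed by `π`.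
      ≡⟨ cong (λ t → ⟦ t ⟧ + sum (λ b → ⟦ lt (q (suc b)) j ⟧)) (lt-irrefl j) ⟨
    sum (λ a → ⟦ lt (q a) j ⟧)
      ≡⟨ sum-permute (λ c → ⟦ lt c j ⟧) π ⟨
    sum (λ c → ⟦ lt c j ⟧)
      ≡⟨ ∑-lt j ⟩
    toℕ j ∎

-- The leading value 0 costs no inversions, and `lt (suc a) (suc b)` reduces to `lt a b`, so the
-- shift of the other values is invisible.
permSign-lift₀ : (π : Permutation m p) → permSign (lift₀ π) ≡ permSign π
permSign-lift₀ π = cong [-1]^_ (begin
  inversions (lift₀ π ⟨$⟩ʳ_)          ≡⟨ inversions-head (lift₀ π) ⟩
  inversions (λ a → suc (π ⟨$⟩ʳ a))   ≡⟨ inversions-lt (λ a → suc (π ⟨$⟩ʳ a)) ⟩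
  _                                   ≡⟨ inversions-lt (π ⟨$⟩ʳ_) ⟨
  inversions (π ⟨$⟩ʳ_)                ∎)

permSign-cong : {π ρ : Permutation m p} → (∀ a → π ⟨$⟩ʳ a ≡ ρ ⟨$⟩ʳ a) →
                permSign π ≡ permSign ρ
permSign-cong {π = π} {ρ} π≗ρ = cong [-1]^_ (∑∑-cong λ a b →
  cong₂ (λ s t → if ⌊ a <? b ⌋ ∧ ⌊ s <? t ⌋ then 1 else 0) (π≗ρ b) (π≗ρ a))

-- Incidence signs as permutation signs

∃∈-≡ : {F : Subset n} {y z : ∃ (_∈ F)} → proj₁ y ≡ proj₁ z → y ≡ z
∃∈-≡ refl = cong (_ ,_) ([]=-irrelevant _ _)

module _ {F G : Subset n} (∣G∣≡ : ∣ G ∣ ≡ suc ∣ F ∣) where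

  -- The removed vertex comes first, followed by `F` in the order `v`. Comparing this ordering with
  -- `w` yields a genuine permutation, which `positions` alone is not.
  adjoin : F ⊂ G → Ordering m F → Ordering p G → Ordering (suc m) G
  adjoin {m} (F⊆G , x , x∈G , x∉F) v w = mk↔ₛ′ to from to-from from-to
    where
    to : Fin (suc m) → ∃ (_∈ G)
    to zero    = x , x∈G
    to (suc a) = let (z , z∈F) = Inverse.to v a in z , F⊆G z∈F

    from : ∃ (_∈ G) → Fin (suc m)
    from (y , y∈G) with y ∈? F
    ... | yes y∈F = suc (Inverse.from v (y , y∈F))
    ... | no  _   = zero

    to-from : ∀ y → to (from y) ≡ y
    to-from (y , y∈G) with y ∈? F
    ... | yes y∈F = ∃∈-≡ (cong proj₁ (Inverse.strictlyInverseˡ v (y , y∈F)))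
    ... | no  y∉F = ∃∈-≡ (removed-unique v w ∣G∣≡ F⊆G x∈G x∉F y∈G y∉F)

    from-to : ∀ a → from (to a) ≡ a
    from-to zero with x ∈? F
    ... | yes x∈F = contradiction x∈F x∉F
    ... | no  _   = refl
    from-to (suc a) with proj₁ (Inverse.to v a) ∈? F
    ... | yes z∈F = cong suc
      (trans (cong (Inverse.from v) (∃∈-≡ refl)) (Inverse.strictlyInverseʳ v a))
    ... | no  z∉F = contradiction (let (_ , z∈F) = Inverse.to v a in z∈F) z∉F

  -- By `inversions-head`, the removed vertex in front contributes its position in `w` and the rest
  -- contributes the inversions of `positions`: these are the two factors of `sgn`.
  sgn-adjoin : (e : F ⊂ G) (v : Ordering m F) (w : Ordering p G) →
               sgn v w e ≡ permSign (↔-trans (adjoin e v w) (↔-sym w))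
  sgn-adjoin e@(_ , x , x∈G , _) v w = sym (trans
    (cong [-1]^_ (inversions-head (↔-trans (adjoin e v w) (↔-sym w))))
    ([-1]^-+ (toℕ (Inverse.from w (x , x∈G))) _))

-- Incidence signs under injective vertex maps

module _ {f : Fin m → Fin n} (f-inj : Injective _≡_ _≡_ f) where

  ∈-image⁻′ : ∀ {F : Subset m} {x} → f x ∈ image f F → x ∈ F
  ∈-image⁻′ {F} fx∈ with ∈-image⁻ f F fx∈
  ... | y , y∈F , fy≡fx rewrite f-inj fy≡fx = y∈F

  image-↔ : (F : Subset m) → ∃ (_∈ F) ↔ ∃ (_∈ image f F)
  image-↔ F = mk↔ₛ′
    (λ (x , x∈F) → f x , ∈-image⁺ f F x∈F)
    (λ (y , y∈) → let (x , x∈F , _) = ∈-image⁻ f F y∈ in x , x∈F)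
    (λ (y , y∈) → let (_ , _ , fx≡y) = ∈-image⁻ f F y∈ in ∃∈-≡ fx≡y)
    (λ (x , x∈F) → let (_ , _ , fy≡fx) = ∈-image⁻ f F (∈-image⁺ f F x∈F) in ∃∈-≡ (f-inj fy≡fx))

  -- The sign of this permutation serves as the switching factor of the face `F`.
  relabel : {F : Subset m} → Ordering p F → Ordering r (image f F) → Permutation p r
  relabel v v′ = ↔-trans (↔-trans v (image-↔ _)) (↔-sym v′)

  image-⊆⁺ : {F G : Subset m} → F ⊆ G → image f F ⊆ image f G
  image-⊆⁺ {F} {G} F⊆G y∈ with ∈-image⁻ f F y∈
  ... | x , x∈F , refl = ∈-image⁺ f G (F⊆G x∈F)

  image-⊆⁻ : {F G : Subset m} → image f F ⊆ image f G → F ⊆ G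
  image-⊆⁻ {F} fF⊆fG x∈F = ∈-image⁻′ (fF⊆fG (∈-image⁺ f F x∈F))

  image-⊂⁺ : {F G : Subset m} → F ⊂ G → image f F ⊂ image f G
  image-⊂⁺ {F} {G} (F⊆G , x , x∈G , x∉F) =
    image-⊆⁺ F⊆G , f x , ∈-image⁺ f G x∈G , x∉F ∘ ∈-image⁻′

  image-⊂⁻ : {F G : Subset m} → image f F ⊂ image f G → F ⊂ G
  image-⊂⁻ {F} {G} (fF⊆fG , y , y∈ , y∉) with ∈-image⁻ f G y∈
  ... | x , x∈G , refl = image-⊆⁻ fF⊆fG , x , x∈G , y∉ ∘ ∈-image⁺ f F

  -- With `sgn-adjoin` every factor is a permutation sign. The two sides belong to the two ways
  -- around a commuting square from the positions of `G`, removed vertex first, to the positions in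
  -- `w′`.
  sgn-image : {F G : Subset m} → ∣ G ∣ ≡ suc ∣ F ∣ → ∣ image f G ∣ ≡ suc ∣ image f F ∣ →
    ∀ {p p′ r r′} (v : Ordering p F) (v′ : Ordering p′ (image f F))
    (w : Ordering r G) (w′ : Ordering r′ (image f G)) (e : F ⊂ G) →
    permSign (relabel v v′) *ˢ sgn v′ w′ (image-⊂⁺ e) ≡ sgn v w e *ˢ permSign (relabel w w′)
  sgn-image {F} {G} ∣G∣≡ ∣fG∣≡ v v′ w w′ e@(F⊆G , x , x∈G , x∉F) = begin
    permSign (relabel v v′) *ˢ sgn v′ w′ e′
      ≡⟨ cong₂ _*ˢ_ (sym (permSign-lift₀ (relabel v v′))) (sgn-adjoin ∣fG∣≡ e′ v′ w′) ⟩
    permSign (lift₀ (relabel v v′)) *ˢ permSign q′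
      ≡⟨ permSign-∘ (lift₀ (relabel v v′)) q′ ⟨
    permSign (lift₀ (relabel v v′) ∘ₚ q′)
      ≡⟨ permSign-cong {π = lift₀ (relabel v v′) ∘ₚ q′} {ρ = q ∘ₚ relabel w w′} square ⟩
    permSign (q ∘ₚ relabel w w′)
      ≡⟨ permSign-∘ q (relabel w w′) ⟩
    permSign q *ˢ permSign (relabel w w′)
      ≡⟨ cong (_*ˢ permSign (relabel w w′)) (sgn-adjoin ∣G∣≡ e v w) ⟨
    sgn v w e *ˢ permSign (relabel w w′) ∎
    where
    e′ = image-⊂⁺ e
    q  = ↔-trans (adjoin ∣G∣≡ e v w) (↔-sym w)
    q′ = ↔-trans (adjoin ∣fG∣≡ e′ v′ w′) (↔-sym w′)

    square : ∀ a → q′ ⟨$⟩ʳ (lift₀ (relabel v v′) ⟨$⟩ʳ a) ≡ relabel w w′ ⟨$⟩ʳ (q ⟨$⟩ʳ a)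
    square zero = cong (Inverse.from w′) (∃∈-≡
      (cong (f ∘ proj₁) (sym (Inverse.strictlyInverseˡ w (x , x∈G)))))
    square (suc a) = cong (Inverse.from w′) (∃∈-≡ (trans
      (cong proj₁ (Inverse.strictlyInverseˡ v′ _))
      (cong (f ∘ proj₁) (sym (Inverse.strictlyInverseˡ w _)))))

-- Walks in signed graphs

open SignedGraph using (Vertex; Edge; sign; edge-sym; sign-sym; sign-unique)

walkSign-◅◅ : ∀ (Γ : SignedGraph) {x y z} (w : Walk Γ x y) (w′ : Walk Γ y z) →
              walkSign Γ (w ◅◅ w′) ≡ walkSign Γ w *ˢ walkSign Γ w′
walkSign-◅◅ Γ ε        w′ = refl
walkSign-◅◅ Γ (e ◅ w) w′ =
  trans (cong (sign Γ e *ˢ_) (walkSign-◅◅ Γ w w′)) (sym (*-assoc (sign Γ e) _ _))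

-- Arbitrary closed walks, unlike cycles, are stable under concatenation and under replacing a
-- segment.
Positive : SignedGraph → Set
Positive Γ = ∀ {x} (c : Walk Γ x x) → walkSign Γ c ≡ +ˢ

positive⇒balanced : ∀ {Γ} → Positive Γ → Balanced Γ
positive⇒balanced pos c _ = pos c

module _ (Γ : SignedGraph) (_≟ᵛ_ : DecidableEquality (Vertex Γ))
         (no-loops : ∀ {x} → ¬ Edge Γ x x) (balanced : Balanced Γ) where

  open DecMembership _≟ᵛ_ using () renaming (_∈?_ to _∈ₗ?_)

  -- The end point is included, in contrast to `vertices`, so that `Unique (support p)` expresses
  -- that `p` is a path.
  support : ∀ {x y} → Walk Γ x y → List (Vertex Γ)
  support {x} ε       = x ∷ []
  support {x} (_ ◅ w) = x ∷ support w

  end∈support : ∀ {x y} (w : Walk Γ x y) → y ∈ₗ support w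
  end∈support ε       = here refl
  end∈support (_ ◅ w) = there (end∈support w)

  split : ∀ {x y z} (w : Walk Γ x y) → z ∈ₗ support w →
          ∃₂ λ (w₁ : Walk Γ x z) (w₂ : Walk Γ z y) →
            support w ≡ vertices Γ w₁ ++ support w₂ × w ≡ w₁ ◅◅ w₂
  split ε       (here refl) = ε , ε , refl , refl
  split (e ◅ w) (here refl) = ε , e ◅ w , refl , refl
  split (e ◅ w) (there z∈)  = let (w₁ , w₂ , supp , w≡) = split w z∈ in
    e ◅ w₁ , w₂ , cong (_ ∷_) supp , cong (e ◅_) w≡

  start∉prefix : ∀ {y z} xs (w : Walk Γ y z) → Unique (xs ++ support w) →
                 Unique xs × All (y ≢_) xs × Unique (support w)
  start∉prefix []       w         u         = [] , [] , u
  start∉prefix (x ∷ xs) w         (x∉ ∷ u) =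
    let (uxs , y∉xs , uw) = start∉prefix xs w u in
    ++⁻ˡ xs x∉ ∷ uxs , ≢-sym (All.lookup x∉ (start∈ xs w)) ∷ y∉xs , uw
    where
    start∈ : ∀ {y z} xs (w : Walk Γ y z) → y ∈ₗ xs ++ support w
    start∈ []       ε       = here refl
    start∈ []       (_ ◅ _) = here refl
    start∈ (_ ∷ xs) w       = there (start∈ xs w)

  -- Walks of length two are not cycles in the sense of `IsCycle`, but they traverse one edge back
  -- and forth, so their sign is a square. From length three on, balance applies.
  simple-closed : ∀ {x y} (e : Edge Γ x y) (w : Walk Γ y x) →
                  Unique (vertices Γ (e ◅ w)) → walkSign Γ (e ◅ w) ≡ +ˢ
  simple-closed e ε              _ = contradiction e no-loops
  simple-closed e (e′ ◅ ε)       _ = begin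
    sign Γ e *ˢ (sign Γ e′ *ˢ +ˢ)  ≡⟨ cong (sign Γ e *ˢ_) (*-identityʳ _) ⟩
    sign Γ e *ˢ sign Γ e′          ≡⟨ cong (sign Γ e *ˢ_) (sign-unique Γ e′ (edge-sym Γ e)) ⟩
    sign Γ e *ˢ sign Γ (edge-sym Γ e) ≡⟨ cong (sign Γ e *ˢ_) (sign-sym Γ e) ⟩
    sign Γ e *ˢ sign Γ e           ≡⟨ s*s≡+ (sign Γ e) ⟩
    +ˢ                             ∎
  simple-closed e w@(_ ◅ _ ◅ _) u = balanced (e ◅ w) (s≤s (s≤s (s≤s z≤n)) , u)

  -- If `x` already lies on the path `p`, then `e` and the part of `p` up to `x` form a simple
  -- closed walk. It is positive and can be cut off.
  to-path : ∀ {x y} (w : Walk Γ x y) →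
            ∃ λ (p : Walk Γ x y) → Unique (support p) × walkSign Γ w ≡ walkSign Γ p
  to-path ε = ε , [] ∷ [] , refl
  to-path {x} (e ◅ w) with to-path w
  ... | p , u , w≡p with x ∈ₗ? support p
  ...   | no x∉p  = e ◅ p , ¬Any⇒All¬ _ x∉p ∷ u , cong (sign Γ e *ˢ_) w≡p
  ...   | yes x∈p with split p x∈p
  ...     | p₁ , p₂ , supp , refl
          with start∉prefix (vertices Γ p₁) p₂ (subst Unique supp u)
  ...       | u₁ , x∉p₁ , u₂ = p₂ , u₂ , (begin
    sign Γ e *ˢ walkSign Γ w
      ≡⟨ cong (sign Γ e *ˢ_) w≡p ⟩
    sign Γ e *ˢ walkSign Γ (p₁ ◅◅ p₂)
      ≡⟨ walkSign-◅◅ Γ (e ◅ p₁) p₂ ⟩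
    walkSign Γ (e ◅ p₁) *ˢ walkSign Γ p₂
      ≡⟨ cong (_*ˢ walkSign Γ p₂) (simple-closed e p₁ (x∉p₁ ∷ u₁)) ⟩
    walkSign Γ p₂ ∎)

  -- The path extracted from a closed walk returns to its start, so it must be empty.
  balanced⇒positive : Positive Γ
  balanced⇒positive c with to-path c
  ... | ε     , _        , c≡p = c≡p
  ... | _ ◅ p , x∉p ∷ _ , _   = contradiction refl (All.lookup x∉p (end∈support p))

-- Induced subgraphs and switching embeddings

infix 5 _↾_

-- Vertices outside `P` remain as isolated points, so that walks in different restrictions share one
-- vertex type.
_↾_ : (Γ : SignedGraph) → (Vertex Γ → Set) → SignedGraph
Γ ↾ P = record
  { Vertex      = Vertex Γ
  ; Edge        = λ x y → P x × Edge Γ x y × P y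
  ; edge-sym    = λ (Px , e , Py) → Py , edge-sym Γ e , Px
  ; sign        = λ (_ , e , _) → sign Γ e
  ; sign-sym    = λ (_ , e , _) → sign-sym Γ e
  ; sign-unique = λ (_ , e , _) (_ , e′ , _) → sign-unique Γ e e′
  }

-- An isomorphism onto an induced subgraph up to switching by η.
record Embedding (Γ Γ′ : SignedGraph) : Set where
  field
    map           : Vertex Γ → Vertex Γ′
    map-injective : Injective _≡_ _≡_ map
    η             : Vertex Γ → Sign
    edge⁺         : ∀ {x y} → Edge Γ x y → Edge Γ′ (map x) (map y)
    edge⁻         : ∀ {x y} → Edge Γ′ (map x) (map y) → Edge Γ x y
    sign-edge⁺    : ∀ {x y} (e : Edge Γ x y) →
                    η x *ˢ sign Γ′ (edge⁺ e) ≡ sign Γ e *ˢ η y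

  Image : Vertex Γ′ → Set
  Image y = ∃ λ x → map x ≡ y

-- This is the induction step along a walk: the switching factor of the middle vertex is passed on
-- and disappears from the total.
switch-* : ∀ a b c s {s′} t {t′} → a *ˢ s′ ≡ s *ˢ b → b *ˢ t′ ≡ t *ˢ c →
           a *ˢ (s′ *ˢ t′) ≡ (s *ˢ t) *ˢ c
switch-* a b c s {s′} t {t′} as′≡sb bt′≡tc = begin
  a *ˢ (s′ *ˢ t′)  ≡⟨ *-assoc a s′ t′ ⟨
  (a *ˢ s′) *ˢ t′  ≡⟨ cong (_*ˢ t′) as′≡sb ⟩
  (s *ˢ b) *ˢ t′   ≡⟨ *-assoc s b t′ ⟩
  s *ˢ (b *ˢ t′)   ≡⟨ cong (s *ˢ_) bt′≡tc ⟩
  s *ˢ (t *ˢ c)    ≡⟨ *-assoc s t c ⟨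
  (s *ˢ t) *ˢ c    ∎

switch-closed : ∀ a {s s′} → a *ˢ s′ ≡ s *ˢ a → s′ ≡ s
switch-closed a {s} {s′} eq = *-cancelˡ-≡ a s′ s (trans eq (*-comm s a))

switch-sym : ∀ a b s s′ → a *ˢ s′ ≡ s *ˢ b → b *ˢ s′ ≡ s *ˢ a
switch-sym a b s s′ as′≡sb = *-cancelˡ-≡ s _ _ (begin
  s *ˢ (b *ˢ s′)   ≡⟨ *-assoc s b s′ ⟨
  (s *ˢ b) *ˢ s′   ≡⟨ cong (_*ˢ s′) as′≡sb ⟨
  (a *ˢ s′) *ˢ s′  ≡⟨ *-assoc a s′ s′ ⟩
  a *ˢ (s′ *ˢ s′)  ≡⟨ cong (a *ˢ_) (s*s≡+ s′) ⟩
  a *ˢ +ˢ          ≡⟨ *-comm a +ˢ ⟩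
  +ˢ *ˢ a          ≡⟨ cong (_*ˢ a) (s*s≡+ s) ⟨
  (s *ˢ s) *ˢ a    ≡⟨ *-assoc s s a ⟩
  s *ˢ (s *ˢ a)    ∎)

module _ {Γ Γ′ : SignedGraph} (φ : Embedding Γ Γ′) where
  open Embedding φ

  push : ∀ {x y} (w : Walk Γ x y) → ∃ λ (w′ : Walk Γ′ (map x) (map y)) →
         η x *ˢ walkSign Γ′ w′ ≡ walkSign Γ w *ˢ η y
  push {x} ε = ε , *-identityʳ (η x)
  push {x} {y} (_◅_ {j = z} e w) = let (w′ , eq) = push w in
    edge⁺ e ◅ w′ , switch-* (η x) (η z) (η y) (sign Γ e) (walkSign Γ w) (sign-edge⁺ e) eq

  positive-pull : Positive Γ′ → Positive Γ
  positive-pull pos {x} c = let (c′ , eq) = push c in trans (sym (switch-closed (η x) eq)) (pos c′)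

  -- Only following the walk shows that its end lies in the image, hence the existential `y`.
  pull : ∀ {x y′} (w : Walk (Γ′ ↾ Image) (map x) y′) →
         ∃₂ λ y (w′ : Walk Γ x y) → map y ≡ y′ ×
         η x *ˢ walkSign (Γ′ ↾ Image) w ≡ walkSign Γ w′ *ˢ η y
  pull {x} ε = x , ε , refl , *-identityʳ (η x)
  pull {x} ((_ , e , (z , refl)) ◅ w) = let (y , w′ , y≡ , eq) = pull w in
    y , edge⁻ e ◅ w′ , y≡ ,
    switch-* (η x) (η z) (η y) (sign Γ (edge⁻ e)) (walkSign Γ w′) sign-e eq
    where
    sign-e : η x *ˢ sign Γ′ e ≡ sign Γ (edge⁻ e) *ˢ η z
    sign-e = trans (cong (η x *ˢ_) (sign-unique Γ′ e (edge⁺ (edge⁻ e)))) (sign-edge⁺ (edge⁻ e))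

  positive-push : Positive Γ → Positive (Γ′ ↾ Image)
  -- The base point of an empty walk may lie outside the image, so this case cannot go through
  -- `pull`.
  positive-push pos ε = refl
  positive-push pos c@(((x , refl) , _) ◅ _) with pull c
  -- Injectivity of `map` makes the pulled-back walk closed.
  ... | y , c′ , y≡x , eq with map-injective y≡x
  ...   | refl = trans (switch-closed (η x) eq) (pos c′)

-- Gluing two positive subgraphs

module _ (Γ : SignedGraph) where

  -- Connectedness of the intersection, phrased so that an empty intersection qualifies.
  Linked : (P Q : Vertex Γ → Set) → Set
  Linked P Q = ∀ {x y} → P x → Q x → P y → Q y → Walk (Γ ↾ λ z → P z × Q z) x y

  EdgeCover : (P Q : Vertex Γ → Set) → Set
  EdgeCover P Q = ∀ {x y} → Edge Γ x y → (P x × P y) ⊎ (Q x × Q y)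

  ↾-mono : ∀ {P Q : Vertex Γ → Set} → (∀ {x} → P x → Q x) → ∀ {x y} (w : Walk (Γ ↾ P) x y) →
           ∃ λ (w′ : Walk (Γ ↾ Q) x y) → walkSign (Γ ↾ Q) w′ ≡ walkSign (Γ ↾ P) w
  ↾-mono P⇒Q ε = ε , refl
  ↾-mono P⇒Q ((Px , e , Py) ◅ w) = let (w′ , eq) = ↾-mono P⇒Q w in
    (P⇒Q Px , e , P⇒Q Py) ◅ w′ , cong (sign Γ e *ˢ_) eq

  module _ {P Q : Vertex Γ → Set} (cover : EdgeCover P Q) (linked : Linked P Q)
           (posP : Positive (Γ ↾ P)) (posQ : Positive (Γ ↾ Q)) where

    -- In Γ ↾ P as in Γ ↾ Q, every walk from x to t has the sign of any walk
    -- from t to x, and the latter can be taken in the intersection.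
    transfer : ∀ {x t} → P x → Q x → P t → Q t → (w : Walk (Γ ↾ Q) x t) →
               ∃ λ (w′ : Walk (Γ ↾ P) x t) → walkSign (Γ ↾ P) w′ ≡ walkSign (Γ ↾ Q) w
    transfer Px Qx Pt Qt w =
      let (out , _) = ↾-mono proj₁ (linked Px Qx Pt Qt)
          back             = linked Pt Qt Px Qx
          (backP , backP≡) = ↾-mono proj₁ back
          (backQ , backQ≡) = ↾-mono proj₂ back
      in out , *-cancelʳ-≡ _ _ _ (begin
        walkSign (Γ ↾ P) out *ˢ walkSign (Γ ↾ P) backP
          ≡⟨ walkSign-◅◅ (Γ ↾ P) out backP ⟨
        walkSign (Γ ↾ P) (out ◅◅ backP)
          ≡⟨ posP (out ◅◅ backP) ⟩
        +ˢ
          ≡⟨ posQ (w ◅◅ backQ) ⟨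
        walkSign (Γ ↾ Q) (w ◅◅ backQ)
          ≡⟨ walkSign-◅◅ (Γ ↾ Q) w backQ ⟩
        walkSign (Γ ↾ Q) w *ˢ walkSign (Γ ↾ Q) backQ
          ≡⟨ cong (walkSign (Γ ↾ Q) w *ˢ_) (trans backQ≡ (sym backP≡)) ⟩
        walkSign (Γ ↾ Q) w *ˢ walkSign (Γ ↾ P) backP ∎)

    mutual
      -- An edge assigned to `Q` starts an excursion. `exit` follows it to a shared vertex `t`, and
      -- `transfer` replaces it by a walk in `P` of the same sign.
      confine : ∀ {x y} (w : Walk Γ x y) → P x → P y →
                ∃ λ (w′ : Walk (Γ ↾ P) x y) → walkSign (Γ ↾ P) w′ ≡ walkSign Γ w
      confine ε Px Py = ε , refl
      confine (e ◅ w) Px Py with cover e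
      ... | inj₁ (_ , Pz) = let (w′ , eq) = confine w Pz Py in
        (Px , e , Pz) ◅ w′ , cong (sign Γ e *ˢ_) eq
      ... | inj₂ (Qx , Qz) with exit w Qz Py
      ...   | t , Pt , Qt , w₂ , w₁ , eq with transfer Px Qx Pt Qt ((Qx , e , Qz) ◅ w₂)
      ...     | w₂′ , eq₂ = w₂′ ◅◅ w₁ , (begin
        walkSign (Γ ↾ P) (w₂′ ◅◅ w₁)
          ≡⟨ walkSign-◅◅ (Γ ↾ P) w₂′ w₁ ⟩
        walkSign (Γ ↾ P) w₂′ *ˢ walkSign (Γ ↾ P) w₁
          ≡⟨ cong (_*ˢ walkSign (Γ ↾ P) w₁) eq₂ ⟩
        sign Γ e *ˢ walkSign (Γ ↾ Q) w₂ *ˢ walkSign (Γ ↾ P) w₁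
          ≡⟨ *-assoc (sign Γ e) _ _ ⟩
        sign Γ e *ˢ (walkSign (Γ ↾ Q) w₂ *ˢ walkSign (Γ ↾ P) w₁)
          ≡⟨ cong (sign Γ e *ˢ_) eq ⟩
        sign Γ e *ˢ walkSign Γ w ∎)

      -- The excursion ends at the first vertex whose next edge is assigned to `P`, or at the end of
      -- the walk. The remainder comes back already confined to `P`, which keeps the mutual
      -- recursion structural.
      exit : ∀ {x y} (w : Walk Γ x y) → Q x → P y →
             ∃ λ t → P t × Q t × ∃₂ λ (w₂ : Walk (Γ ↾ Q) x t) (w₁ : Walk (Γ ↾ P) t y) →
               walkSign (Γ ↾ Q) w₂ *ˢ walkSign (Γ ↾ P) w₁ ≡ walkSign Γ w
      exit {x} ε Qx Px = x , Px , Qx , ε , ε , refl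
      exit {x} (e ◅ w) Qx Py with cover e
      ... | inj₁ (Px , Pz) = let (w′ , eq) = confine w Pz Py in
        x , Px , Qx , ε , (Px , e , Pz) ◅ w′ , cong (sign Γ e *ˢ_) eq
      ... | inj₂ (_ , Qz) = let (t , Pt , Qt , w₂ , w₁ , eq) = exit w Qz Py in
        t , Pt , Qt , (Qx , e , Qz) ◅ w₂ , w₁ ,
        trans (*-assoc (sign Γ e) _ _) (cong (sign Γ e *ˢ_) eq)

  -- The side to which the first edge is assigned contains the base point, and the whole closed walk
  -- can be confined to that side.
  positive-∪ : ∀ {P Q : Vertex Γ → Set} → EdgeCover P Q → Linked P Q →
               Positive (Γ ↾ P) → Positive (Γ ↾ Q) → Positive Γ
  positive-∪ cover linked posP posQ ε = refl
  positive-∪ cover linked posP posQ c@(e ◅ _) with cover e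
  ... | inj₁ (Px , _) =
    let (c′ , eq) = confine cover linked posP posQ c Px Px in trans (sym eq) (posP c′)
  ... | inj₂ (Qx , _) =
    let (c′ , eq) = confine (swap ∘ cover) linked′ posQ posP c Qx Qx in trans (sym eq) (posQ c′)
    where
    linked′ : Linked _ _
    linked′ Qx Px Qy Py = proj₁ (↾-mono (λ (Pz , Qz) → Qz , Pz) (linked Px Qx Py Qy))

-- Faces of the wedge sum

⊆⇒⊂⊎≡ : {F G : Subset n} → F ⊆ G → F ⊂ G ⊎ F ≡ G
⊆⇒⊂⊎≡ {F = F} {G} F⊆G with any? (λ x → (x ∈? G) ×-dec ¬? (x ∈? F))
... | yes (x , x∈G , x∉F) = inj₁ (F⊆G , x , x∈G , x∉F)
... | no  ∄ = inj₂ (⊆-antisym F⊆G λ {x} x∈G →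
  decidable-stable (x ∈? F) λ x∉F → ∄ (x , x∈G , x∉F))

⊆∧∣≥∣⇒≡ : {F G : Subset n} → F ⊆ G → ∣ G ∣ ≤ ∣ F ∣ → F ≡ G
⊆∧∣≥∣⇒≡ F⊆G ∣G∣≤∣F∣ with ⊆⇒⊂⊎≡ F⊆G
... | inj₁ F⊂G = contradiction ∣G∣≤∣F∣ (<⇒≱ (p⊂q⇒∣p∣<∣q∣ F⊂G))
... | inj₂ F≡G = F≡G

⊆∧∣<∣⇒⊂ : {F G : Subset n} → F ⊆ G → ∣ F ∣ < ∣ G ∣ → F ⊂ G
⊆∧∣<∣⇒⊂ F⊆G ∣F∣<∣G∣ with ⊆⇒⊂⊎≡ F⊆G
... | inj₁ F⊂G  = F⊂G
... | inj₂ refl = contradiction ∣F∣<∣G∣ (<-irrefl refl)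

module _ {K : SimplicialComplex n} where

  S-≡ : ∀ {d} {F G : S d K} → set F ≡ set G → F ≡ G
  S-≡ refl = refl

  -- Decidability recovers a usable proof from the irrelevant field, which makes it possible to ask
  -- from which summand a face of the wedge comes.
  face : ∀ {d} (F : S d K) → IsFace K (set F)
  face (mkS F F∈K _) = recompute (isFace? K F) F∈K

  card : ∀ {d} (F : S d K) → ∣ set F ∣ ≡ suc d
  card (mkS _ _ ∣F∣≡) = recompute (_ ≟ⁿ _) ∣F∣≡

  module _ (i : ℕ) (o : Orientation K) where

    vset : Vert i K o → Subset n
    vset (inj₁ F) = set F
    vset (inj₂ G) = set G

    _≟ᵛ_ : DecidableEquality (Vert i K o)
    _≟ᵛ_ = ⊎-≡-dec _≟ˢ_ _≟ˢ_
      where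
      _≟ˢ_ : ∀ {d} → DecidableEquality (S d K)
      F ≟ˢ G = map′ S-≡ (cong set) (Vec-≡-dec _≟ᵇ_ (set F) (set G))

    B-balanced⇒positive : Balanced (B i K o) → Positive (B i K o)
    B-balanced⇒positive = balanced⇒positive (B i K o) _≟ᵛ_ no-loops
      where
      no-loops : ∀ {x} → ¬ Inc i K o x x
      no-loops {inj₁ _} ()
      no-loops {inj₂ _} ()

-- The embedding of `B i K` induced by a vertex injection

module _ {K : SimplicialComplex m} {K′ : SimplicialComplex n}
         (o : Orientation K) (o′ : Orientation K′)
         {f : Fin m → Fin n} (f-inj : Injective _≡_ _≡_ f)
         (f-face : ∀ {F} → IsFace K F → IsFace K′ (image f F)) where

  -- The orientations enumerate `F` and its image, and `f` matches the two enumerations by a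
  -- bijection.
  ∣image∣ : ∀ {F} → .(IsFace K F) → ∣ image f F ∣ ≡ ∣ F ∣
  ∣image∣ {F} F∈K = sym (↔⇒≡ (relabel f-inj (o F F∈K) (o′ (image f F) (f-face F∈K))))

  imageS : ∀ {d} → S d K → S d K′
  imageS (mkS F F∈K ∣F∣≡) = mkS (image f F) (f-face F∈K) (trans (∣image∣ F∈K) ∣F∣≡)

  imageS-injective : ∀ {d} → Injective _≡_ _≡_ (imageS {d})
  imageS-injective {x = F} {G} eq = S-≡ (⊆-antisym (sub (cong set eq)) (sub (sym (cong set eq))))
    where
    sub : ∀ {F G} → image f F ≡ image f G → F ⊆ G
    sub fF≡fG = image-⊆⁻ f-inj λ {y} → subst (y ∈_) fF≡fG

  imageS-surjective : ∀ {d} (G : S d K′) → IsImageFace f K (set G) → ∃ λ F → imageS F ≡ G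
  imageS-surjective (mkS _ _ ∣G∣≡) (F , F∈K , refl) =
    mkS F F∈K (trans (sym (∣image∣ F∈K)) ∣G∣≡) , refl

  module _ (i : ℕ) where

    imageV : Vert i K o → Vert i K′ o′
    imageV (inj₁ F) = inj₁ (imageS F)
    imageV (inj₂ G) = inj₂ (imageS G)

    imageV-injective : Injective _≡_ _≡_ imageV
    imageV-injective {inj₁ F} {inj₁ G} eq = cong inj₁ (imageS-injective (inj₁-injective eq))
    imageV-injective {inj₂ F} {inj₂ G} eq = cong inj₂ (imageS-injective (inj₂-injective eq))

    -- The sign by which f carries the chosen orientation of a face to that of its image.
    ηˢ : ∀ {d} → S d K → Sign
    ηˢ (mkS F F∈K _) = permSign (relabel f-inj (o F F∈K) (o′ (image f F) (f-face F∈K)))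

    η : Vert i K o → Sign
    η (inj₁ F) = ηˢ F
    η (inj₂ G) = ηˢ G

    B-embedding : Embedding (B i K o) (B i K′ o′)
    B-embedding = record
      { map           = imageV
      ; map-injective = imageV-injective
      ; η             = η
      ; edge⁺         = λ {x} {y} → edge⁺ x y
      ; edge⁻         = λ {x} {y} → edge⁻ x y
      ; sign-edge⁺    = λ {x} {y} → sign-edge⁺ x y
      }
      where
      edge⁺ : ∀ x y → Inc i K o x y → Inc i K′ o′ (imageV x) (imageV y)
      edge⁺ (inj₁ _) (inj₂ _) = image-⊂⁺ f-inj
      edge⁺ (inj₂ _) (inj₁ _) = image-⊂⁺ f-inj

      edge⁻ : ∀ x y → Inc i K′ o′ (imageV x) (imageV y) → Inc i K o x y
      edge⁻ (inj₁ _) (inj₂ _) = image-⊂⁻ f-inj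
      edge⁻ (inj₂ _) (inj₁ _) = image-⊂⁻ f-inj

      incSign-image : ∀ F G e →
        ηˢ F *ˢ incSign i K′ o′ (inj₁ (imageS F)) (inj₂ (imageS G)) (image-⊂⁺ f-inj e) ≡
        incSign i K o (inj₁ F) (inj₂ G) e *ˢ ηˢ G
      incSign-image F@(mkS F₀ F∈K _) G@(mkS G₀ G∈K _) = sgn-image f-inj
        (card-suc i K o F G) (card-suc i K′ o′ (imageS F) (imageS G))
        (o F₀ F∈K) (o′ (image f F₀) (f-face F∈K))
        (o G₀ G∈K) (o′ (image f G₀) (f-face G∈K))

      sign-edge⁺ : ∀ x y e → η x *ˢ incSign i K′ o′ (imageV x) (imageV y) (edge⁺ x y e) ≡
                             incSign i K o x y e *ˢ η y
      sign-edge⁺ (inj₁ F) (inj₂ G) e = incSign-image F G e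
      sign-edge⁺ (inj₂ G) (inj₁ F) e = switch-sym
        (ηˢ F) (ηˢ G) (incSign i K o (inj₁ F) (inj₂ G) e) _ (incSign-image F G e)

    open Embedding B-embedding using (Image)

    image⇒Image : ∀ x → IsImageFace f K (vset i o′ x) → Image x
    image⇒Image (inj₁ F) p = let (F′ , eq) = imageS-surjective F p in inj₁ F′ , cong inj₁ eq
    image⇒Image (inj₂ G) p = let (G′ , eq) = imageS-surjective G p in inj₂ G′ , cong inj₂ eq

    Image⇒image : ∀ {x} → Image x → IsImageFace f K (vset i o′ x)
    Image⇒image (inj₁ F , refl) = set F , face F , refl
    Image⇒image (inj₂ G , refl) = set G , face G , refl

-- The two copies inside the wedge and their intersection

module _ {n₁ n₂ k : ℕ} (K₁ : SimplicialComplex n₁) (K₂ : SimplicialComplex n₂)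
         (F₁ : S k K₁) (F₂ : S k K₂)
         (v : Ordering (suc k) (set F₁)) (u : Ordering (suc k) (set F₂)) where

  private
    K : SimplicialComplex (n₁ + n₂)
    K = wedge K₁ K₂ F₁ F₂ v u
    ι : Fin n₁ → Fin (n₁ + n₂)
    ι = ι₁ K₁ K₂ F₁ F₂ v u
    κ : Fin n₂ → Fin (n₁ + n₂)
    κ = ι₂ K₁ K₂ F₁ F₂ v u

  glue : ∃ (_∈ set F₂) → ∃ (_∈ set F₁)
  glue y = Inverse.to v (Inverse.from u y)

  ι₂-glued : ∀ {y} (y∈F₂ : y ∈ set F₂) → κ y ≡ ι (proj₁ (glue (y , y∈F₂)))
  ι₂-glued {y} y∈F₂ with y ∈? set F₂
  ... | yes _    = cong (ι ∘ proj₁ ∘ glue) (∃∈-≡ refl)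
  ... | no  y∉F₂ = contradiction y∈F₂ y∉F₂

  ι₁≢↑ʳ : ∀ x y → ι x ≢ n₁ ↑ʳ y
  ι₁≢↑ʳ x y eq
    with trans (sym (splitAt-↑ˡ n₁ x n₂)) (trans (cong (splitAt n₁) eq) (splitAt-↑ʳ n₁ n₂ y))
  ... | ()

  ι₁-injective : Injective _≡_ _≡_ ι
  ι₁-injective = ↑ˡ-injective n₂ _ _

  ι₂-injective : Injective _≡_ _≡_ κ
  ι₂-injective {y} {z} eq with y ∈? set F₂ | z ∈? set F₂
  ... | yes y∈F₂ | yes z∈F₂ = cong proj₁
    (Injection.injective (↔⇒↣ (↔-sym u))
      (Injection.injective (↔⇒↣ v) (∃∈-≡ (ι₁-injective eq))))
  ... | yes y∈F₂ | no  _    = contradiction eq (ι₁≢↑ʳ _ z)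
  ... | no  _    | yes z∈F₂ = contradiction (sym eq) (ι₁≢↑ʳ _ y)
  ... | no  _    | no  _    = ↑ʳ-injective n₁ y z eq

  common : Subset (n₁ + n₂)
  common = image ι (set F₁)

  -- A vertex coming from `K₁` is never of the form `n₁ ↑ʳ y`, so its preimage under `ι₂` must be
  -- one of the glued vertices of `F₂`.
  ⊆common : ∀ {G} → IsImageFace ι K₁ G → IsImageFace κ K₂ G → G ⊆ common
  ⊆common (H₁ , _ , refl) (H₂ , _ , H₂≡H₁) {z} z∈G
    with ∈-image⁻ ι H₁ z∈G | ∈-image⁻ κ H₂ (subst (z ∈_) (sym H₂≡H₁) z∈G)
  ... | x , _ , ιx≡z | y , _ , κy≡z with y ∈? set F₂
  ...   | yes y∈F₂ = subst (_∈ common) κy≡z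
    (∈-image⁺ ι (set F₁) (proj₂ (glue (y , y∈F₂))))
  ...   | no  _    = contradiction (trans ιx≡z (sym κy≡z)) (ι₁≢↑ʳ x y)

  image-ι₂ : image κ (set F₂) ≡ common
  image-ι₂ = ⊆-antisym sub sup
    where
    sub : image κ (set F₂) ⊆ common
    sub z∈ with ∈-image⁻ κ (set F₂) z∈
    ... | y , y∈F₂ , refl = subst (_∈ common) (sym (ι₂-glued y∈F₂))
      (∈-image⁺ ι (set F₁) (proj₂ (glue (y , y∈F₂))))

    sup : common ⊆ image κ (set F₂)
    sup z∈ with ∈-image⁻ ι (set F₁) z∈
    ... | x , x∈F₁ , refl =
      subst (_∈ image κ (set F₂)) (trans (ι₂-glued y∈F₂) (cong (ι ∘ proj₁) glue-y))
        (∈-image⁺ κ (set F₂) y∈F₂)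
      where
      y    = Inverse.to u (Inverse.from v (x , x∈F₁))
      y∈F₂ = proj₂ y
      glue-y : glue y ≡ (x , x∈F₁)
      glue-y = trans (cong (Inverse.to v) (Inverse.strictlyInverseʳ u _))
                     (Inverse.strictlyInverseˡ v _)

  common₁ : IsImageFace ι K₁ common
  common₁ = set F₁ , face F₁ , refl

  common₂ : IsImageFace κ K₂ common
  common₂ = set F₂ , face F₂ , image-ι₂

  face₁ : ∀ {F} → IsFace K₁ F → IsFace K (image ι F)
  face₁ F∈K₁ = inj₁ (_ , F∈K₁ , refl)

  face₂ : ∀ {F} → IsFace K₂ F → IsFace K (image κ F)
  face₂ F∈K₂ = inj₂ (_ , F∈K₂ , refl)

  module _ (o₁ : Orientation K₁) (o₂ : Orientation K₂) (o : Orientation K) (i : ℕ) where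

    φ₁ : Embedding (B i K₁ o₁) (B i K o)
    φ₁ = B-embedding o₁ o ι₁-injective face₁ i

    φ₂ : Embedding (B i K₂ o₂) (B i K o)
    φ₂ = B-embedding o₂ o ι₂-injective face₂ i

    P₁ P₂ : Vert i K o → Set
    P₁ = Embedding.Image φ₁
    P₂ = Embedding.Image φ₂

    P₁⁺ : ∀ x → IsImageFace ι K₁ (vset i o x) → P₁ x
    P₁⁺ = image⇒Image o₁ o ι₁-injective face₁ i

    P₂⁺ : ∀ x → IsImageFace κ K₂ (vset i o x) → P₂ x
    P₂⁺ = image⇒Image o₂ o ι₂-injective face₂ i

    vset⊆common : ∀ {x} → P₁ x → P₂ x → vset i o x ⊆ common
    vset⊆common P₁x P₂x = ⊆common (Image⇒image o₁ o ι₁-injective face₁ i P₁x)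
                                  (Image⇒image o₂ o ι₂-injective face₂ i P₂x)

    -- The larger face of an edge comes from one of the summands, and its subface comes from the
    -- same summand by down-closure.
    cover : EdgeCover (B i K o) P₁ P₂
    cover {inj₁ F} {inj₂ G} (F⊆G , _) with face G
    ... | inj₁ G₁ = inj₁ (P₁⁺ (inj₁ F) (image-down-closed ι K₁ G₁ F⊆G) , P₁⁺ (inj₂ G) G₁)
    ... | inj₂ G₂ = inj₂ (P₂⁺ (inj₁ F) (image-down-closed κ K₂ G₂ F⊆G) , P₂⁺ (inj₂ G) G₂)
    cover {inj₂ G} {inj₁ F} (F⊆G , _) with face G
    ... | inj₁ G₁ = inj₁ (P₁⁺ (inj₂ G) G₁ , P₁⁺ (inj₁ F) (image-down-closed ι K₁ G₁ F⊆G))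
    ... | inj₂ G₂ = inj₂ (P₂⁺ (inj₂ G) G₂ , P₂⁺ (inj₁ F) (image-down-closed κ K₂ G₂ F⊆G))

    ∣common∣ : ∣ common ∣ ≡ suc k
    ∣common∣ = trans (∣image∣ {K = K₁} {K′ = K} o₁ o ι₁-injective face₁ (face F₁)) (card F₁)

    -- Shared faces lie in `common`, which has `k + 1` elements. This is too few for an
    -- `(i+1)`-face, and an `i`-face can only fit by filling it.
    shared-above : k ≤ i → ∀ {x} → P₁ x → P₂ x → ∃ λ F → x ≡ inj₁ F × set F ≡ common
    shared-above k≤i {inj₁ F} P₁x P₂x = F , refl , ⊆∧∣≥∣⇒≡ (vset⊆common P₁x P₂x)
      (subst₂ _≤_ (sym ∣common∣) (sym (card F)) (s≤s k≤i))
    shared-above k≤i {inj₂ G} P₁x P₂x = contradiction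
      (subst₂ _≤_ (card G) ∣common∣ (p⊆q⇒∣p∣≤∣q∣ (vset⊆common P₁x P₂x)))
      (<⇒≱ (s≤s (s≤s k≤i)))

    linked-above : k ≤ i → Linked (B i K o) P₁ P₂
    linked-above k≤i P₁x P₂x P₁y P₂y
      with shared-above k≤i P₁x P₂x | shared-above k≤i P₁y P₂y
    ... | F , refl , F≡ | G , refl , G≡ with S-≡ {F = F} {G} (trans F≡ (sym G≡))
    ...   | refl = ε

    -- Here `common` is itself a vertex of the graph, of the upper kind. Any shared `i`-face is a
    -- proper subset of it, so all connections run through this hub.
    linked-at : k ≡ suc i → Linked (B i K o) P₁ P₂
    linked-at refl P₁x P₂x P₁y P₂y = to-hub P₁x P₂x ◅◅ from-hub P₁y P₂y
      where
      hub : Vert i K o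
      hub = inj₂ (mkS common (inj₁ common₁) ∣common∣)

      near : ∀ {x} → P₁ x → P₂ x → x ≡ hub ⊎ Inc i K o x hub
      near {inj₁ F} P₁x P₂x = inj₂ (⊆∧∣<∣⇒⊂ (vset⊆common P₁x P₂x)
        (subst₂ _<_ (sym (card F)) (sym ∣common∣) (n<1+n _)))
      near {inj₂ G} P₁x P₂x = inj₁ (cong inj₂ (S-≡ (⊆∧∣≥∣⇒≡ (vset⊆common P₁x P₂x)
        (≤-reflexive (trans ∣common∣ (sym (card G)))))))

      both-hub : P₁ hub × P₂ hub
      both-hub = P₁⁺ hub common₁ , P₂⁺ hub common₂

      to-hub : ∀ {x} → P₁ x → P₂ x → Walk (B i K o ↾ λ z → P₁ z × P₂ z) x hub
      to-hub P₁x P₂x with near P₁x P₂x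
      ... | inj₁ refl = ε
      ... | inj₂ e    = ((P₁x , P₂x) , e , both-hub) ◅ ε

      from-hub : ∀ {x} → P₁ x → P₂ x → Walk (B i K o ↾ λ z → P₁ z × P₂ z) hub x
      from-hub {x} P₁x P₂x with near P₁x P₂x
      ... | inj₁ refl = ε
      ... | inj₂ e    = (both-hub , Inc-sym i K o x hub e , (P₁x , P₂x)) ◅ ε

    linked : k ≤ suc i → Linked (B i K o) P₁ P₂
    linked k≤1+i with m≤n⇒m<n∨m≡n k≤1+i
    ... | inj₁ (s≤s k≤i) = linked-above k≤i
    ... | inj₂ k≡1+i     = linked-at k≡1+i

-- The equivalence

mainTheorem5 : ∀ {n₁ n₂ : ℕ} (K₁ : SimplicialComplex n₁) (K₂ : SimplicialComplex n₂)
    (k : ℕ) (F₁ : S k K₁) (F₂ : S k K₂)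
    (v : Ordering (suc k) (set F₁)) (u : Ordering (suc k) (set F₂))
    (o₁ : Orientation K₁) (o₂ : Orientation K₂)
    (o : Orientation (wedge K₁ K₂ F₁ F₂ v u))
    (i : ℕ) → k ≤ suc i →
    Balanced (B i (wedge K₁ K₂ F₁ F₂ v u) o) ⇔
    (Balanced (B i K₁ o₁) × Balanced (B i K₂ o₂))
mainTheorem5 K₁ K₂ k F₁ F₂ v u o₁ o₂ o i k≤1+i = mk⇔ restrict combine
  where
  K  = wedge K₁ K₂ F₁ F₂ v u
  ψ₁ = φ₁ K₁ K₂ F₁ F₂ v u o₁ o₂ o i
  ψ₂ = φ₂ K₁ K₂ F₁ F₂ v u o₁ o₂ o i

  restrict : Balanced (B i K o) → Balanced (B i K₁ o₁) × Balanced (B i K₂ o₂)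
  restrict bal =
    positive⇒balanced {B i K₁ o₁} (positive-pull ψ₁ (B-balanced⇒positive {K = K} i o bal)) ,
    positive⇒balanced {B i K₂ o₂} (positive-pull ψ₂ (B-balanced⇒positive {K = K} i o bal))

  combine : Balanced (B i K₁ o₁) × Balanced (B i K₂ o₂) → Balanced (B i K o)
  combine (bal₁ , bal₂) = positive⇒balanced {B i K o} (positive-∪ (B i K o)
    (λ {x} {y} → cover K₁ K₂ F₁ F₂ v u o₁ o₂ o i {x} {y})
    (linked K₁ K₂ F₁ F₂ v u o₁ o₂ o i k≤1+i)
    (positive-push ψ₁ (B-balanced⇒positive {K = K₁} i o₁ bal₁))
    (positive-push ψ₂ (B-balanced⇒positive {K = K₂} i o₂ bal₂)))
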